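{- The random graph has no automatic presentation.
   Context: The random graph is the Fraïssé limit of the class of all finite (undirected, loopless) graphs, i.e. the unique up to isomorphism countable graph $(V,E)$ that is ultra-homogeneous (every isomorphism between finite substructures extends to an automorphism) and whose finite substructures are, up to isomorphism, exactly all finite graphs. For $\diamond\notin\Sigma$, the convolution $\otimes(w_1,\dots,w_n)$ of a tuple of words over a finite alphabet $\Sigma$ is the word of length $\max_i|w_i|$ over $(\Sigma\cup\{\diamond\})^n$ whose $k$-th symbol is $(\sigma_1,\dots,\sigma_n)$, where $\sigma_i$ is the $k$-th symbol of $w_i$ if $k\le|w_i|$ and $\sigma_i=\diamond$ otherwise. A relation $R\subseteq(\Sigma^\star)^n$ is FA recognisable if $\{\otimes w: w\in R\}$ is a regular language. A structure has an automatic presentation if it is isomorphic to a structure whose domain is a regular subset of $\Sigma^\star$ for some finite alphabet $\Sigma$ and whose atomic relations are FA recognisable. -}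

module Defs where

open import Level using (0ℓ)
open import Data.Nat using (ℕ; _⊔_)
open import Data.Fin using (Fin)
open import Data.Fin.Subset using (Subset; _∈_)
open import Data.List as List using (List)
open import Data.Maybe using (Maybe)
open import Data.Product using (∃; ∃-syntax; _×_; proj₁)
open import Data.Unit using (⊤; tt)
open import Data.Vec as Vec using (Vec; []; _∷_)
open import Function.Bundles using (_⇔_; _↔_; _↣_; Inverse; Injection)
open import Relation.Binary using (Irreflexive; Rel; Symmetric)
open import Relation.Binary.PropositionalEquality using (_≡_)
open import Relation.Unary using (Pred; Decidable)

record Signature : Set₁ where
  field
    Symbol : Set
    arity  : Symbol → ℕ

open Signature public

record Structure (σ : Signature) : Set₁ where
  field
    Carrier : Set
    rel     : (s : Symbol σ) → Pred (Vec Carrier (arity σ s)) 0ℓ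

open Structure public

infix 4 _≅_

record _≅_ {σ : Signature} (M N : Structure σ) : Set where
  field
    bijection : Carrier M ↔ Carrier N

  to : Carrier M → Carrier N
  to = Inverse.to bijection

  field
    preserves : ∀ s xs → rel M s xs ⇔ rel N s (Vec.map to xs)

-- A finite subset is given by an enumeration without repetitions.  The
-- substructure it induces is carried by the indices of that enumeration.

record FiniteSubset (X : Set) : Set where
  field
    size : ℕ
    enum : Fin size ↣ X

  at : Fin size → X
  at = Injection.to enum

open FiniteSubset public using (size; at)

infix 8 _∣_

_∣_ : ∀ {σ} (M : Structure σ) → FiniteSubset (Carrier M) → Structure σ
M ∣ S = record
  { Carrier = Fin (size S)
  ; rel     = λ s is → rel M s (Vec.map (at S) is)
  }

-- Relations of finite structures are required to be decidable.  This is
-- automatic classically; without it, no structure with decidable relations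
-- could be shown constructively to contain a copy of every finite graph.

record FiniteStructure (σ : Signature) : Set₁ where
  field
    structure : Structure σ
    order     : ℕ
    finite    : Carrier structure ↔ Fin order
    rel?      : ∀ s → Decidable (rel structure s)

open FiniteStructure public using (structure)

UltraHomogeneous : ∀ {σ} → Structure σ → Set
UltraHomogeneous M =
  (S T : FiniteSubset (Carrier M)) (φ : M ∣ S ≅ M ∣ T) →
  ∃[ α ] ∀ i → _≅_.to {M = M} {N = M} α (at S i) ≡ at T (_≅_.to φ i)

HasAge : ∀ {σ} → Structure σ → Pred (FiniteStructure σ) 0ℓ → Set₁
HasAge M K = ∀ H → (∃[ S ] structure H ≅ M ∣ S) ⇔ K H

Countable : Set → Set
Countable X = X ↣ ℕ

record IsFraïsséLimit {σ : Signature} (K : Pred (FiniteStructure σ) 0ℓ)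
                      (M : Structure σ) : Set₁ where
  field
    countable        : Countable (Carrier M)
    ultraHomogeneous : UltraHomogeneous M
    age              : HasAge M K

graphSignature : Signature
graphSignature = record { Symbol = ⊤ ; arity = λ _ → 2 }

Edge : (G : Structure graphSignature) → Rel (Carrier G) 0ℓ
Edge G x y = rel G tt (x ∷ y ∷ [])

record IsGraph (G : Structure graphSignature) : Set where
  field
    undirected : Symmetric (Edge G)
    loopless   : Irreflexive _≡_ (Edge G)

record IsRandomGraph (G : Structure graphSignature) : Set₁ where
  field
    isGraph        : IsGraph G
    isFraïsséLimit : IsFraïsséLimit (λ H → IsGraph (structure H)) G

record DFA (A : Set) : Set where
  field
    states : ℕ
    start  : Fin states
    step   : Fin states → A → Fin states
    final  : Subset states

-- Membership is a proposition (it is an instance of Vec's _[_]=_), so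
-- ∃ (Language 𝒜) is the set of accepted words, without multiplicities.

Language : ∀ {A : Set} → DFA A → Pred (List A) 0ℓ
Language 𝒜 w = List.foldl step start w ∈ final
  where open DFA 𝒜

Regular : ∀ {A : Set} → Pred (List A) 0ℓ → Set
Regular {A} L = ∃[ 𝒜 ] ∀ w → L w ⇔ Language {A} 𝒜 w

-- The padding symbol ⋄ is nothing; head (drop k w) is the symbol of w at the
-- zero-based position k, or nothing if k ≥ length w.

⊗ : ∀ {A : Set} {n} → Vec (List A) n → List (Vec (Maybe A) n)
⊗ ws = List.applyUpTo
  (λ k → Vec.map (λ w → List.head (List.drop k w)) ws)
  (Vec.foldr′ _⊔_ 0 (Vec.map List.length ws))

FARecognisable : ∀ {A : Set} {n} → Pred (Vec (List A) n) 0ℓ → Set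
FARecognisable R = Regular (λ u → ∃[ ws ] R ws × u ≡ ⊗ ws)

record AutomaticPresentation {σ : Signature} (M : Structure σ) : Set₁ where
  field
    alphabetSize : ℕ

  Alphabet : Set
  Alphabet = Fin alphabetSize

  field
    domain    : DFA Alphabet
    relations : ∀ s → Pred (Vec (∃ (Language domain)) (arity σ s)) 0ℓ

  presented : Structure σ
  presented = record { Carrier = ∃ (Language domain) ; rel = relations }

  field
    recognisable : ∀ s → FARecognisable
      (λ ws → ∃[ xs ] relations s xs × ws ≡ Vec.map proj₁ xs)
    isomorphism  : M ≅ presented

{-# OPTIONS --safe #-}

-- Let d n be the number of words of length ≤ n in the domain, c and q the
-- numbers of states of the automata for the domain and for the edge relation.
-- In the random graph each of the 2 ^ d n subsets of these words is the set of
-- neighbours, among them, of some vertex x.  Cut x after its first n symbols.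
-- Which of the words are adjacent to x depends only on this prefix and on the
-- set of states from which the edge automaton accepts the padded rest of x.  By
-- pumping, the prefix extends to a word of length ≤ n + c in the domain, so
-- 2 ^ d n ≤ d (n + c) * 2 ^ q.  Since d is unbounded, d grows along an
-- arithmetic progression like an iterated exponential, whereas d n ≤ (k + 1) ^ n
-- for an alphabet of size k.

module Submission where

open import Defs
open import Data.Bool as Bool using (Bool; true)
open import Data.Bool.Properties using (⇔→≡)
open import Data.Empty using (⊥)
open import Data.Fin using (Fin; zero; suc; toℕ; combine; funToFin; finToFun)
open import Data.Fin.Properties as Fin using
  ( pigeonhole; injective⇒≤; combine-injective; 2↔Bool; toℕ≤pred[n]
  ; finToFun-funToFin; funToFin-finToFin )
open import Data.Fin.Subset as Subset using ()
open import Data.Fin.Subset.Properties using (_∈?_)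
open import Data.List using
  ( List; []; _∷_; _++_; length; lookup; head; take; drop; map; mapMaybe; filter
  ; foldl; allFin; applyUpTo; cartesianProductWith )
open import Data.List.Membership.Propositional using (_∈_)
open import Data.List.Membership.Propositional.Properties using
  ( ∈-lookup; ∈-allFin; ∈-filter⁺; ∈-filter⁻
  ; ∈-cartesianProductWith⁺; ∈-cartesianProductWith⁻ )
open import Data.List.Properties using
  ( length-++; length-map; length-tabulate; length-take; length-drop; length-filter
  ; take++drop≡id; drop-[]; foldl-++; ++-identityʳ )
open import Data.List.Relation.Unary.All as All using ([])
open import Data.List.Relation.Unary.AllPairs using ([]; _∷_)
open import Data.List.Relation.Unary.Any using (here; there; index)
open import Data.List.Relation.Unary.Any.Properties using (lookup-index)
open import Data.List.Relation.Unary.Unique.Propositional using (Unique)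
open import Data.List.Relation.Unary.Unique.Propositional.Properties using
  (cartesianProductWith⁺; filter⁺; allFin⁺)
open import Data.Maybe using (Maybe; just; nothing)
open import Data.Nat
open import Data.Nat.Induction using (<-wellFounded)
open import Data.Nat.Properties
open import Data.Nat.Tactic.RingSolver using (solve-∀)
open import Data.Product using (∃; ∃-syntax; _×_; _,_; proj₁; proj₂)
open import Data.Unit using (tt)
open import Data.Vec as Vec using (Vec; []; _∷_)
open import Data.Vec.Properties using ([]=⇒lookup; lookup⇒[]=)
open import Data.Vec.Properties.WithK using ([]=-irrelevant)
open import Function
open import Function.Construct.Composition using (_⇔-∘_)
open import Function.Construct.Identity using (↔-id)
open import Function.Construct.Symmetry using (↔-sym; ⇔-sym)
open import Function.Properties.Inverse using (↔⇒↣)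
open import Induction.WellFounded using (Acc; acc)
open import Level using (0ℓ)
open import Relation.Binary as Binary using (Rel; Symmetric; Irreflexive)
open import Relation.Binary.PropositionalEquality
open import Relation.Nullary using (¬_; yes; no; contradiction)
open import Relation.Nullary.Decidable using (map′)
open import Relation.Unary as Unary using ()

private
  variable
    A B : Set
    m n : ℕ

-- Finite lists, finite functions and counting by codes.

lookup-injective : ∀ {xs : List A} → Unique xs → ∀ i j → lookup xs i ≡ lookup xs j → i ≡ j
lookup-injective (_ ∷ _)   zero    zero    _  = refl
lookup-injective (x∉ ∷ _)  zero    (suc j) eq = contradiction eq (All.lookup x∉ (∈-lookup j))
lookup-injective (x∉ ∷ _)  (suc i) zero    eq = contradiction (sym eq) (All.lookup x∉ (∈-lookup i))
lookup-injective (_ ∷ xs!) (suc i) (suc j) eq = cong suc (lookup-injective xs! i j eq)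

bounded : (f : Fin m → ℕ) → ∃[ b ] ∀ i → f i ≤ b
bounded {zero}  f = 0 , λ ()
bounded {suc m} f with b , f≤b ← bounded (f ∘ suc) = f zero ⊔ b , λ where
  zero    → m≤m⊔n (f zero) b
  (suc i) → ≤-trans (f≤b i) (m≤n⊔m (f zero) b)

funToFin-cong : {f g : Fin m → Fin n} → f ≗ g → funToFin f ≡ funToFin g
funToFin-cong {zero}  f≗g = refl
funToFin-cong {suc m} f≗g = cong₂ combine (f≗g zero) (funToFin-cong (f≗g ∘ suc))

funToFin-injective : {f g : Fin m → Fin n} → funToFin f ≡ funToFin g → f ≗ g
funToFin-injective {f = f} {g} eq i = begin
  f i                      ≡⟨ finToFun-funToFin f i ⟨
  finToFun (funToFin f) i  ≡⟨ cong (λ k → finToFun k i) eq ⟩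
  finToFun (funToFin g) i  ≡⟨ finToFun-funToFin g i ⟩
  g i                      ∎
  where open ≡-Reasoning

finToFun-injective : {a b : Fin (n ^ m)} → finToFun {n} {m} a ≗ finToFun b → a ≡ b
finToFun-injective {n} {m} {a} {b} eq = begin
  a                      ≡⟨ funToFin-finToFin {m} {n} a ⟨
  funToFin {m} (finToFun a)  ≡⟨ funToFin-cong eq ⟩
  funToFin {m} (finToFun b)  ≡⟨ funToFin-finToFin {m} {n} b ⟩
  b                      ∎
  where open ≡-Reasoning

-- The pair of `f P` and `g P` codes `P` by one of `k * 2 ^ n` numbers. Arguments are taken in the
-- form `decode a`, so that their pointwise equality already gives equality of the numbers `a`.
2^m≤k*2^n : ∀ {k} (f : (Fin m → Bool) → Fin k) (g : (Fin m → Bool) → Fin n → Bool) →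
  (∀ {P Q} → f P ≡ f Q → g P ≗ g Q → P ≗ Q) → 2 ^ m ≤ k * 2 ^ n
2^m≤k*2^n {m} {n} {k} f g injective = injective⇒≤ encode-injective
  where
  open Inverse 2↔Bool using () renaming (to to toBool; from to fromBool)

  toBool-injective : Injective _≡_ _≡_ toBool
  toBool-injective = Injection.injective (↔⇒↣ 2↔Bool)

  fromBool-injective : Injective _≡_ _≡_ fromBool
  fromBool-injective = Injection.injective (↔⇒↣ (↔-sym 2↔Bool))

  decode : Fin (2 ^ m) → Fin m → Bool
  decode a = toBool ∘ finToFun a

  encode : Fin (2 ^ m) → Fin (k * 2 ^ n)
  encode a = combine (f (decode a)) (funToFin (fromBool ∘ g (decode a)))

  encode-injective : Injective _≡_ _≡_ encode
  encode-injective {a} {b} eq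
    with f≡ , g≡ ← combine-injective (f (decode a)) _ (f (decode b)) _ eq
    = finToFun-injective {m = m} λ i →
        toBool-injective (injective f≡ (fromBool-injective ∘ funToFin-injective g≡) i)

-- Convolution of two words.

applyUpTo-cong : {f g : ℕ → A} → f ≗ g → ∀ n → applyUpTo f n ≡ applyUpTo g n
applyUpTo-cong f≗g zero    = refl
applyUpTo-cong f≗g (suc n) = cong₂ _∷_ (f≗g 0) (applyUpTo-cong (f≗g ∘ suc) n)

-- In its uses `g` completes a symbol to a column whose other entry is padding.
applyUpTo-head-drop : (g : Maybe A → B) (xs : List A) →
  applyUpTo (λ k → g (head (drop k xs))) (length xs) ≡ map (g ∘ just) xs
applyUpTo-head-drop g []       = refl
applyUpTo-head-drop g (x ∷ xs) = cong (g (just x) ∷_) (applyUpTo-head-drop g xs)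

padʳ padˡ : A → Vec (Maybe A) 2
padʳ a = just a ∷ nothing ∷ []
padˡ a = nothing ∷ just a ∷ []

-- The binary case of `⊗` by structural recursion instead of by positions, so that splitting and
-- projecting go by induction.
conv : List A → List A → List (Vec (Maybe A) 2)
conv []       []       = []
conv (x ∷ xs) []       = padʳ x ∷ conv xs []
conv []       (y ∷ ys) = padˡ y ∷ conv [] ys
conv (x ∷ xs) (y ∷ ys) = (just x ∷ just y ∷ []) ∷ conv xs ys

conv-[]ʳ : (xs : List A) → conv xs [] ≡ map padʳ xs
conv-[]ʳ []       = refl
conv-[]ʳ (x ∷ xs) = cong (padʳ x ∷_) (conv-[]ʳ xs)

conv-[]ˡ : (ys : List A) → conv [] ys ≡ map padˡ ys
conv-[]ˡ []       = refl
conv-[]ˡ (y ∷ ys) = cong (padˡ y ∷_) (conv-[]ˡ ys)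

⊗≡conv : (xs ys : List A) → ⊗ (xs ∷ ys ∷ []) ≡ conv xs ys
⊗≡conv {A} xs [] = begin
  ⊗ (xs ∷ [] ∷ [])                     ≡⟨ cong (applyUpTo _) (⊔-identityʳ (length xs)) ⟩
  applyUpTo (λ k → head (drop k xs) ∷ head {A = A} (drop k []) ∷ []) (length xs)
    ≡⟨ applyUpTo-cong (λ k →
         cong (λ (ys : List A) → head (drop k xs) ∷ head ys ∷ []) (drop-[] k)) (length xs) ⟩
  applyUpTo (λ k → head (drop k xs) ∷ nothing ∷ []) (length xs)
    ≡⟨ applyUpTo-head-drop (λ a → a ∷ nothing ∷ []) xs ⟩
  map padʳ xs                          ≡⟨ conv-[]ʳ xs ⟨
  conv xs []                           ∎
  where open ≡-Reasoning
⊗≡conv {A} [] ys@(_ ∷ _) = begin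
  ⊗ ([] ∷ ys ∷ [])
    ≡⟨ applyUpTo-cong (λ k →
         cong (λ (xs : List A) → head xs ∷ head (drop k ys) ∷ []) (drop-[] k)) (length ys) ⟩
  applyUpTo (λ k → nothing ∷ head (drop k ys) ∷ []) (length ys)
    ≡⟨ applyUpTo-head-drop (λ a → nothing ∷ a ∷ []) ys ⟩
  map padˡ ys                          ≡⟨ conv-[]ˡ ys ⟨
  conv [] ys                           ∎
  where open ≡-Reasoning
⊗≡conv (x ∷ xs) (y ∷ ys) = cong ((just x ∷ just y ∷ []) ∷_) (begin
  applyUpTo symbols (length xs ⊔ length ys)
    -- The `⊔ 0` that ends the fold in `⊗` computes away on `suc (length ys)` but not on
    -- `length ys`; it is restored to match the induction hypothesis.
    ≡⟨ cong (λ n → applyUpTo symbols (length xs ⊔ n)) (⊔-identityʳ (length ys)) ⟨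
  ⊗ (xs ∷ ys ∷ [])                           ≡⟨ ⊗≡conv xs ys ⟩
  conv xs ys                                 ∎)
  where
  open ≡-Reasoning
  symbols = λ k → head (drop k xs) ∷ head (drop k ys) ∷ []

-- Padding is `nothing`, so `mapMaybe` erases it from a track; this is why a convolution determines
-- its two words.
conv⇒firsts : (xs ys : List A) → mapMaybe Vec.head (conv xs ys) ≡ xs
conv⇒firsts []       []       = refl
conv⇒firsts (x ∷ xs) []       = cong (x ∷_) (conv⇒firsts xs [])
conv⇒firsts []       (y ∷ ys) = conv⇒firsts [] ys
conv⇒firsts (x ∷ xs) (y ∷ ys) = cong (x ∷_) (conv⇒firsts xs ys)

conv⇒seconds : (xs ys : List A) → mapMaybe Vec.last (conv xs ys) ≡ ys
conv⇒seconds []       []       = refl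
conv⇒seconds (x ∷ xs) []       = conv⇒seconds xs []
conv⇒seconds []       (y ∷ ys) = cong (y ∷_) (conv⇒seconds [] ys)
conv⇒seconds (x ∷ xs) (y ∷ ys) = cong (y ∷_) (conv⇒seconds xs ys)

conv-injective : {xs xs′ ys ys′ : List A} → conv xs ys ≡ conv xs′ ys′ → xs ≡ xs′ × ys ≡ ys′
conv-injective {xs = xs} {xs′} {ys} {ys′} eq =
  trans (sym (conv⇒firsts xs ys)) (trans (cong (mapMaybe Vec.head) eq) (conv⇒firsts xs′ ys′)) ,
  trans (sym (conv⇒seconds xs ys)) (trans (cong (mapMaybe Vec.last) eq) (conv⇒seconds xs′ ys′))

-- Beyond position `n` the second track is all padding, so the rest of `xs` is read in the same way
-- whatever `ys` is.
conv-split : ∀ n (xs ys : List A) → length ys ≤ n →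
  conv xs ys ≡ conv (take n xs) ys ++ map padʳ (drop n xs)
conv-split zero    xs       []       _         = conv-[]ʳ xs
conv-split (suc n) []       ys       _         = sym (++-identityʳ (conv [] ys))
conv-split (suc n) (x ∷ xs) []       _         = cong (padʳ x ∷_) (conv-split n xs [] z≤n)
conv-split (suc n) (x ∷ xs) (y ∷ ys) (s≤s len) =
  cong ((just x ∷ just y ∷ []) ∷_) (conv-split n xs ys len)

length-take≤ : ∀ n (xs : List A) → length (take n xs) ≤ n
length-take≤ n xs = ≤-trans (≤-reflexive (length-take n xs)) (m⊓n≤m n (length xs))

-- Either `take n xs` already fills `n` positions, or `drop n xs` is empty and the bound forces `ys`
-- to be empty too.
take-take-++ : ∀ n (xs ys : List A) → length ys ≤ length (drop n xs) →
  take n (take n xs ++ ys) ≡ take n xs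
take-take-++ zero    xs       ys _ = refl
take-take-++ (suc n) []       [] _ = refl
take-take-++ (suc n) (x ∷ xs) ys ≤ = cong (x ∷_) (take-take-++ n xs ys ≤)

-- Enumeration of the words of bounded length.

words : (k n : ℕ) → List (List (Fin k))
words k zero    = [] ∷ []
words k (suc n) = [] ∷ cartesianProductWith _∷_ (allFin k) (words k n)

∈-words : ∀ {k} (w : List (Fin k)) → length w ≤ n → w ∈ words k n
∈-words {zero}  []      _         = here refl
∈-words {suc n} []      _         = here refl
∈-words {suc n} (a ∷ w) (s≤s len) =
  there (∈-cartesianProductWith⁺ _∷_ (∈-allFin a) (∈-words w len))

words⇒length≤ : ∀ {k w} → w ∈ words k n → length w ≤ n
words⇒length≤ {zero}      (here refl) = z≤n
words⇒length≤ {suc n}     (here refl) = z≤n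
words⇒length≤ {suc n} {k} (there w∈)
  with _ , _ , _ , v∈ , refl ← ∈-cartesianProductWith⁻ _∷_ (allFin k) (words k n) w∈
  = s≤s (words⇒length≤ v∈)

words! : ∀ k n → Unique (words k n)
words! k zero    = [] ∷ []
words! k (suc n) = All.tabulate []∉ ∷
  cartesianProductWith⁺ _∷_ (λ { refl → refl , refl }) (allFin⁺ k) (words! k n)
  where
  []∉ : ∀ {w} → w ∈ cartesianProductWith _∷_ (allFin k) (words k n) → [] ≢ w
  []∉ w∈ refl with _ , _ , _ , _ , () ← ∈-cartesianProductWith⁻ _∷_ (allFin k) (words k n) w∈

length-cartesianProductWith : ∀ {C : Set} (f : A → B → C) xs ys →
  length (cartesianProductWith f xs ys) ≡ length xs * length ys
length-cartesianProductWith f []       ys = refl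
length-cartesianProductWith f (x ∷ xs) ys = begin
  length (map (f x) ys ++ cartesianProductWith f xs ys)  ≡⟨ length-++ (map (f x) ys) ⟩
  length (map (f x) ys) + length (cartesianProductWith f xs ys)
    ≡⟨ cong₂ _+_ (length-map (f x) ys) (length-cartesianProductWith f xs ys) ⟩
  length ys + length xs * length ys                      ∎
  where open ≡-Reasoning

length-words : (k n : ℕ) → length (words k n) ≤ suc k ^ n
length-words k zero    = ≤-refl
length-words k (suc n) = begin
  1 + length (cartesianProductWith _∷_ (allFin k) (words k n))
    ≡⟨ cong suc (length-cartesianProductWith _∷_ (allFin k) (words k n)) ⟩
  1 + length (allFin k) * length (words k n)
    ≡⟨ cong (λ m → 1 + m * length (words k n)) (length-tabulate {n = k} id) ⟩
  1 + k * length (words k n)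
    -- The summand for the empty word is absorbed by one further copy of `suc k ^ n`.
    ≤⟨ +-mono-≤ (m^n>0 (suc k) n) (*-monoʳ-≤ k (length-words k n)) ⟩
  suc k ^ suc n ∎
  where open ≤-Reasoning

-- Runs of automata and pumping.

module Automaton (𝒜 : DFA A) where
  open DFA 𝒜

  run : Fin states → List A → Fin states
  run = foldl step

  -- Deleting a loop of the run.
  pump : ∀ q w → states < length w → ∃[ v ] length v < length w × run q v ≡ run q w
  pump q w long
    -- The prefixes cut at positions 0 to `states` are one more than the states, so two of them
    -- reach the same state.
    with i , j , i<j , loop
      ← pigeonhole ≤-refl (λ (i : Fin (suc states)) → run q (take (toℕ i) w))
    = take (toℕ i) w ++ drop (toℕ j) w , shorter , same
    where
    shorter : length (take (toℕ i) w ++ drop (toℕ j) w) < length w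
    shorter = begin-strict
      length (take (toℕ i) w ++ drop (toℕ j) w)         ≡⟨ length-++ (take (toℕ i) w) ⟩
      length (take (toℕ i) w) + length (drop (toℕ j) w) ≡⟨ cong (_ +_) (length-drop (toℕ j) w) ⟩
      length (take (toℕ i) w) + (length w ∸ toℕ j)      ≤⟨ +-monoˡ-≤ _ (length-take≤ (toℕ i) w) ⟩
      toℕ i + (length w ∸ toℕ j)                        <⟨ +-monoˡ-< _ i<j ⟩
      toℕ j + (length w ∸ toℕ j)                        ≡⟨ m+[n∸m]≡n (≤-trans (toℕ≤pred[n] j) (<⇒≤ long)) ⟩
      length w                                          ∎
      where open ≤-Reasoning

    same : run q (take (toℕ i) w ++ drop (toℕ j) w) ≡ run q w
    same = begin
      run q (take (toℕ i) w ++ drop (toℕ j) w)          ≡⟨ foldl-++ step q (take (toℕ i) w) _ ⟩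
      run (run q (take (toℕ i) w)) (drop (toℕ j) w)     ≡⟨ cong (λ p → run p (drop (toℕ j) w)) loop ⟩
      run (run q (take (toℕ j) w)) (drop (toℕ j) w)     ≡⟨ foldl-++ step q (take (toℕ j) w) _ ⟨
      run q (take (toℕ j) w ++ drop (toℕ j) w)          ≡⟨ cong (run q) (take++drop≡id (toℕ j) w) ⟩
      run q w                                           ∎
      where open ≡-Reasoning

  -- Loops are deleted until none is forced. The bound by `length w` is kept for `take-take-++`: an
  -- empty rest must stay empty.
  shorten : ∀ q w → ∃[ v ] length v ≤ states × length v ≤ length w × run q v ≡ run q w
  shorten q w = go w (<-wellFounded (length w))
    where
    go : ∀ w → Acc _<_ (length w) →
      ∃[ v ] length v ≤ states × length v ≤ length w × run q v ≡ run q w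
    go w (acc rec) with length w ≤? states
    ... | yes short = w , short , ≤-refl , refl
    ... | no ¬short
      with v , v<w , v≡w ← pump q w (≰⇒> ¬short)
      with u , small , u≤v , u≡v ← go v (rec v<w)
      = u , small , ≤-trans u≤v (<⇒≤ v<w) , trans u≡v v≡w

  -- Pumping is applied only to the rest after `n` symbols, starting from the state reached there,
  -- which leaves the prefix intact.
  shorten-beyond : ∀ n w → Language 𝒜 w →
    ∃[ v ] length v ≤ n + states × take n v ≡ take n w × Language 𝒜 v
  shorten-beyond n w w∈L
    with v , v≤states , v≤ , same ← shorten (run start (take n w)) (drop n w)
    = take n w ++ v , len , take-take-++ n w v v≤ , subst (Subset._∈ final) (sym run≡) w∈L
    where
    len : length (take n w ++ v) ≤ n + states
    len = ≤-trans (≤-reflexive (length-++ (take n w))) (+-mono-≤ (length-take≤ n w) v≤states)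

    run≡ : run start (take n w ++ v) ≡ run start w
    run≡ = begin
      run start (take n w ++ v)                ≡⟨ foldl-++ step start (take n w) v ⟩
      run (run start (take n w)) v             ≡⟨ same ⟩
      run (run start (take n w)) (drop n w)    ≡⟨ foldl-++ step start (take n w) (drop n w) ⟨
      run start (take n w ++ drop n w)         ≡⟨ cong (run start) (take++drop≡id n w) ⟩
      run start w                              ∎
      where open ≡-Reasoning

  Language? : Unary.Decidable (Language 𝒜)
  Language? w = run start w ∈? final

-- Growth estimates.

n<2^n : ∀ n → n < 2 ^ n
n<2^n zero    = ≤-refl
n<2^n (suc n) = begin
  1 + suc n      ≤⟨ +-mono-≤ (m^n>0 2 n) (n<2^n n) ⟩
  2 ^ n + 2 ^ n  ≡⟨ cong (2 ^ n +_) (+-identityʳ (2 ^ n)) ⟨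
  2 ^ suc n      ∎
  where open ≤-Reasoning

n+n≤2^n : ∀ n → n + n ≤ 2 ^ n
n+n≤2^n zero    = z≤n
n+n≤2^n (suc n) = begin
  suc n + suc n  ≤⟨ +-mono-≤ (n<2^n n) (n<2^n n) ⟩
  2 ^ n + 2 ^ n  ≡⟨ cong (2 ^ n +_) (+-identityʳ (2 ^ n)) ⟨
  2 ^ suc n      ∎
  where open ≤-Reasoning

linear<exponential : ∀ a b → ∃[ j ] a + b * j < 2 ^ j
-- With `j = a + (b + b)` both the constant and the slope are at most `j`, so the left side is at
-- most `1 + j + j * j`; the doubled exponent provides a square to exceed it.
linear<exponential a b = j + j , (begin
  suc (a + b * (j + j))           ≡⟨ regroup a b j ⟩
  suc (a + (b + b) * j)           ≤⟨ s≤s (+-mono-≤ (m≤m+n a (b + b)) (*-monoˡ-≤ j (m≤n+m (b + b) a))) ⟩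
  suc (j + j * j)                 ≤⟨ m≤n+m _ j ⟩
  j + suc (j + j * j)             ≡⟨ square j ⟩
  suc j * suc j                   ≤⟨ *-mono-≤ (n<2^n j) (n<2^n j) ⟩
  2 ^ j * 2 ^ j                   ≡⟨ ^-distribˡ-+-* 2 j j ⟨
  2 ^ (j + j)                     ∎)
  where
  open ≤-Reasoning
  j = a + (b + b)

  regroup : ∀ a b j → ℕ.suc (a + b * (j + j)) ≡ ℕ.suc (a + (b + b) * j)
  regroup = solve-∀

  square : ∀ j → j + ℕ.suc (j + j * j) ≡ ℕ.suc j * ℕ.suc j
  square = solve-∀

-- From a large enough start, `f` is at least exponential in the number of steps of length `c`. One
-- more step makes it doubly exponential, while `b ^ N` at the linear position `N` is only singly
-- exponential.
tower≰exponential : ∀ (f : ℕ → ℕ) q c b →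
  (∀ n → 2 ^ f n ≤ f (n + c) * 2 ^ q) → (∀ n → f n ≤ b ^ n) →
  (∀ m → ∃[ n ] m ≤ f n) → ⊥
tower≰exponential f q c b step upper unbounded
  -- This threshold is the base case of `lower`.
  with n₀ , large ← unbounded (q + (q + 1))
  -- These are the constant term and the slope in `j` of the exponent `b * N + q` reached below
  -- through `b ≤ 2 ^ b`.
  with j , linear<exp ← linear<exponential (b * (n₀ + 2 * c) + q) (b * c)
  = <⇒≱ (^-monoʳ-< 2 (s≤s (s≤s z≤n)) linear<exp) (begin
  2 ^ (2 ^ j)                              ≤⟨ ^-monoʳ-≤ 2 (^-monoʳ-≤ 2 (m≤n+m j (q + 1))) ⟩
  2 ^ (2 ^ (q + 1 + j))                    ≤⟨ ^-monoʳ-≤ 2 (growth j) ⟩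
  2 ^ f (n₀ + suc j * c)                   ≤⟨ step* (suc j) ⟩
  f N * 2 ^ q                              ≤⟨ *-monoˡ-≤ (2 ^ q) (upper N) ⟩
  b ^ N * 2 ^ q                            ≤⟨ *-monoˡ-≤ (2 ^ q) (^-monoˡ-≤ N (<⇒≤ (n<2^n b))) ⟩
  (2 ^ b) ^ N * 2 ^ q                      ≡⟨ cong (_* 2 ^ q) (^-*-assoc 2 b N) ⟩
  2 ^ (b * N) * 2 ^ q                      ≡⟨ ^-distribˡ-+-* 2 (b * N) q ⟨
  2 ^ (b * N + q)                          ≡⟨ cong (2 ^_) (regroup b n₀ c q j) ⟩
  2 ^ (b * (n₀ + 2 * c) + q + b * c * j)   ∎)
  where
  open ≤-Reasoning
  N = n₀ + suc (suc j) * c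

  regroup : ∀ b n₀ c q j → b * (n₀ + suc (suc j) * c) + q ≡ b * (n₀ + 2 * c) + q + b * c * j
  regroup = solve-∀

  step* : ∀ i → 2 ^ f (n₀ + i * c) ≤ f (n₀ + suc i * c) * 2 ^ q
  step* i = subst (λ n → 2 ^ f (n₀ + i * c) ≤ f n * 2 ^ q) (next n₀ c i) (step (n₀ + i * c))
    where
    next : ∀ n₀ c i → n₀ + i * c + c ≡ n₀ + suc i * c
    next = solve-∀

  -- The two bounds alternate: `step*` turns the linear one into the exponential one, the leading
  -- `q` paying for the factor `2 ^ q`, and `n+n≤2^n` weakens that to the next linear one.
  lower  : ∀ i → q + (q + 1 + i) ≤ f (n₀ + i * c)
  growth : ∀ i → 2 ^ (q + 1 + i) ≤ f (n₀ + suc i * c)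

  lower zero    = subst₂ (λ k n → q + k ≤ f n)
    (sym (+-identityʳ (q + 1))) (sym (+-identityʳ n₀)) large
  lower (suc i) = begin
    q + (q + 1 + suc i)        ≤⟨ m≤m+n _ i ⟩
    q + (q + 1 + suc i) + i    ≡⟨ double q i ⟩
    (q + 1 + i) + (q + 1 + i)  ≤⟨ n+n≤2^n (q + 1 + i) ⟩
    2 ^ (q + 1 + i)            ≤⟨ growth i ⟩
    f (n₀ + suc i * c)         ∎
    where
    double : ∀ q i → q + (q + 1 + suc i) + i ≡ (q + 1 + i) + (q + 1 + i)
    double = solve-∀

  growth i = *-cancelʳ-≤ _ _ (2 ^ q) {{m^n≢0 2 q}} (begin
    2 ^ (q + 1 + i) * 2 ^ q      ≡⟨ *-comm (2 ^ (q + 1 + i)) (2 ^ q) ⟩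
    2 ^ q * 2 ^ (q + 1 + i)      ≡⟨ ^-distribˡ-+-* 2 q (q + 1 + i) ⟨
    2 ^ (q + (q + 1 + i))        ≤⟨ ^-monoʳ-≤ 2 (lower i) ⟩
    2 ^ f (n₀ + i * c)           ≤⟨ step* i ⟩
    f (n₀ + suc i * c) * 2 ^ q   ∎)

-- Universality and the extension property of the random graph.

module RandomGraph {G : Structure graphSignature} (random : IsRandomGraph G)
                   (Edge? : Binary.Decidable (Edge G)) where

  open IsRandomGraph random
  open IsGraph isGraph
  open IsFraïsséLimit isFraïsséLimit

  -- The age supplies an induced copy of the graph on `Fin n`; following the isomorphism by the
  -- enumeration of the copy gives the embedding.
  embed : ∀ {n} {_~_ : Rel (Fin n) 0ℓ} →
    Binary.Decidable _~_ → Symmetric _~_ → Irreflexive _≡_ _~_ →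
    ∃[ f ] ∀ i j → Edge G (Injection.to f i) (Injection.to f j) ⇔ i ~ j
  embed {n} {_~_} _~?_ ~-sym ~-irrefl = embedding , edges
    where
    H : FiniteStructure graphSignature
    H = record
      { structure = record { Carrier = Fin n ; rel = λ { tt (i ∷ j ∷ []) → i ~ j } }
      ; order     = n
      ; finite    = ↔-id (Fin n)
      ; rel?      = λ { tt (i ∷ j ∷ []) → i ~? j }
      }

    copy : ∃[ S ] structure H ≅ G ∣ S
    copy = Equivalence.from (age H) (record { undirected = ~-sym ; loopless = ~-irrefl })

    S = proj₁ copy
    open _≅_ (proj₂ copy)

    embedding : Fin n ↣ Carrier G
    embedding = mk↣ {to = at S ∘ to} λ eq →
      Injection.injective (↔⇒↣ bijection) (Injection.injective (FiniteSubset.enum S) eq)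

    edges : ∀ i j → Edge G (at S (to i)) (at S (to j)) ⇔ i ~ j
    edges i j = ⇔-sym (preserves tt (i ∷ j ∷ []))

  -- The edgeless graph of every order embeds.
  unbounded : ∀ n → Fin n ↣ Carrier G
  unbounded n = proj₁ (embed {n} {λ _ _ → ⊥} (λ _ _ → no λ ()) (λ ()) (λ _ ()))

  -- Add to `S` a vertex joined as `P` prescribes and embed the result. Ultra-homogeneity moves the
  -- copy of `S` onto `S` by an automorphism, and the image of the added vertex is the witness.
  -- `Edge?` makes the enlarged graph a `FiniteStructure`.
  extension : (S : FiniteSubset (Carrier G)) (P : Fin (size S) → Bool) →
    ∃[ x ] ∀ i → Edge G x (at S i) ⇔ P i ≡ true
  extension S P = _≅_.to α (f zero) , λ i →
    subst (λ y → Edge G (_≅_.to α (f zero)) y ⇔ P i ≡ true) (extends i)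
      (f-edges zero (suc i) ⇔-∘ ⇔-sym (_≅_.preserves α tt (f zero ∷ f (suc i) ∷ [])))
    where
    -- The vertex zero is new; suc i stands for at S i.
    _~_ : Rel (Fin (suc (size S))) 0ℓ
    zero  ~ zero  = ⊥
    zero  ~ suc j = P j ≡ true
    suc i ~ zero  = P i ≡ true
    suc i ~ suc j = Edge G (at S i) (at S j)

    _~?_ : Binary.Decidable _~_
    zero  ~? zero  = no λ ()
    zero  ~? suc j = P j Bool.≟ true
    suc i ~? zero  = P i Bool.≟ true
    suc i ~? suc j = Edge? (at S i) (at S j)

    ~-sym : Symmetric _~_
    ~-sym {zero}  {suc j} p = p
    ~-sym {suc i} {zero}  p = p
    ~-sym {suc i} {suc j} p = undirected {at S i} {at S j} p

    ~-irrefl : Irreflexive _≡_ _~_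
    ~-irrefl {suc i} refl p = loopless refl p

    copy = embed _~?_ (λ {i} {j} → ~-sym {i} {j}) ~-irrefl
    f = Injection.to (proj₁ copy)

    f-edges : ∀ i j → Edge G (f i) (f j) ⇔ i ~ j
    f-edges = proj₂ copy

    T : FiniteSubset (Carrier G)
    T = record
      { size = size S
      ; enum = mk↣ {to = f ∘ suc} (Fin.suc-injective ∘ Injection.injective (proj₁ copy))
      }

    -- Among the old vertices `_~_` is the edge relation on `S`, so matching indices is an
    -- isomorphism.
    T≅S : G ∣ T ≅ G ∣ S
    T≅S = record
      { bijection = ↔-id (Fin (size S))
      ; preserves = λ { tt (i ∷ j ∷ []) → f-edges (suc i) (suc j) }
      }

    α : G ≅ G
    α = proj₁ (ultraHomogeneous T S T≅S)

    extends : ∀ i → _≅_.to α (f (suc i)) ≡ at S i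
    extends = proj₂ (ultraHomogeneous T S T≅S)

-- Counting neighbourhoods in an automatic presentation.

module Presentation {G : Structure graphSignature} (random : IsRandomGraph G)
                    (presentation : AutomaticPresentation G) where

  open AutomaticPresentation presentation
  open _≅_ isomorphism

  ℛ : DFA (Vec (Maybe Alphabet) 2)
  ℛ = proj₁ (recognisable tt)

  module 𝒟 where
    open DFA domain public
    open Automaton domain public

  module R where
    open DFA ℛ public
    open Automaton ℛ public

  Vertex : Set
  Vertex = ∃ (Language domain)

  vertex-≡ : {x y : Vertex} → proj₁ x ≡ proj₁ y → x ≡ y
  vertex-≡ {w , p} {w , q} refl = cong (w ,_) ([]=-irrelevant p q)

  Edge⇔Language : ∀ {x y} →
    Edge G x y ⇔ Language ℛ (conv (proj₁ (to x)) (proj₁ (to y)))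
  Edge⇔Language {x} {y} = mk⇔ sound complete ⇔-∘ preserves tt (x ∷ y ∷ [])
    where
    u = proj₁ (to x)
    v = proj₁ (to y)

    sound : relations tt (to x ∷ to y ∷ []) → Language ℛ (conv u v)
    sound r = Equivalence.to (proj₂ (recognisable tt) (conv u v))
      (u ∷ v ∷ [] , (to x ∷ to y ∷ [] , r , refl) , sym (⊗≡conv u v))

    complete : Language ℛ (conv u v) → relations tt (to x ∷ to y ∷ [])
    complete accepted
      -- Recognisability yields only some related pair with this convolution; injectivity of `conv`
      -- identifies it with `u` and `v`.
      with _ , (x′ ∷ y′ ∷ [] , r , refl) , eq
        ← Equivalence.from (proj₂ (recognisable tt) (conv u v)) accepted
      with u≡ , v≡ ← conv-injective (trans eq (⊗≡conv (proj₁ x′) (proj₁ y′)))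
      = subst₂ (λ x y → relations tt (x ∷ y ∷ []))
          (sym (vertex-≡ u≡)) (sym (vertex-≡ v≡)) r

  -- Running the edge automaton decides adjacency, as `RandomGraph` requires.
  Edge? : Binary.Decidable (Edge G)
  Edge? x y = map′ (Equivalence.from Edge⇔Language) (Equivalence.to Edge⇔Language)
    (R.Language? (conv (proj₁ (to x)) (proj₁ (to y))))

  open RandomGraph random Edge?

  domainWords : ℕ → List (List Alphabet)
  domainWords n = filter 𝒟.Language? (words alphabetSize n)

  domainWords! : ∀ n → Unique (domainWords n)
  domainWords! n = filter⁺ 𝒟.Language? (words! alphabetSize n)

  ∈-domainWords : ∀ {n w} → length w ≤ n → Language domain w → w ∈ domainWords n
  ∈-domainWords len w∈L = ∈-filter⁺ 𝒟.Language? (∈-words _ len) w∈L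

  domainWords⁻ : ∀ {n w} → w ∈ domainWords n → length w ≤ n × Language domain w
  domainWords⁻ {n} w∈
    with w∈words , w∈L ← ∈-filter⁻ 𝒟.Language? {xs = words alphabetSize n} w∈
    = words⇒length≤ w∈words , w∈L

  -- This is the function `d` of the introductory comment.
  census : ℕ → ℕ
  census n = length (domainWords n)

  census≤ : ∀ n → census n ≤ suc alphabetSize ^ n
  census≤ n = ≤-trans (length-filter 𝒟.Language? (words alphabetSize n)) (length-words alphabetSize n)

  census-unbounded : ∀ m → ∃[ n ] m ≤ census n
  -- Here `n` bounds the lengths of the words of `m` distinct vertices, which then occupy distinct
  -- places in `domainWords n`.
  census-unbounded m with n , len ← bounded (length ∘ proj₁ ∘ to ∘ Injection.to (unbounded m))
    = n , injective⇒≤ {f = index ∘ listed} λ {i} {j} eq →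
      Injection.injective (unbounded m) (Injection.injective (↔⇒↣ bijection) (vertex-≡ (begin
        word i                                  ≡⟨ lookup-index (listed i) ⟩
        lookup (domainWords n) (index (listed i)) ≡⟨ cong (lookup (domainWords n)) eq ⟩
        lookup (domainWords n) (index (listed j)) ≡⟨ lookup-index (listed j) ⟨
        word j                                  ∎)))
    where
    open ≡-Reasoning
    word : Fin m → List Alphabet
    word i = proj₁ (to (Injection.to (unbounded m) i))

    listed : ∀ i → word i ∈ domainWords n
    listed i = ∈-domainWords (len i) (proj₂ (to (Injection.to (unbounded m) i)))

  module Types (n : ℕ) where

    entry : Fin (census n) → Vertex
    entry i = lookup (domainWords n) i , proj₂ (domainWords⁻ {n} (∈-lookup i))

    short : FiniteSubset (Carrier G)
    short = record
      { size = census n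
      ; enum = mk↣ {to = Inverse.from bijection ∘ entry} λ {i} {j} eq →
          lookup-injective (domainWords! n) i j
            (cong proj₁ (Injection.injective (↔⇒↣ (↔-sym bijection)) eq))
      }

    Type : Set
    Type = Fin (census n) → Bool

    realisation : Type → List Alphabet
    realisation P = proj₁ (to (proj₁ (extension short P)))

    realisation∈domain : ∀ P → Language domain (realisation P)
    realisation∈domain P = proj₂ (to (proj₁ (extension short P)))

    accepts : Fin R.states → List (Vec (Maybe Alphabet) 2) → Bool
    accepts q w = Vec.lookup R.final (R.run q w)

    -- All that adjacency retains of `w` beyond position `n`: a set of states, hence one of
    -- `2 ^ R.states` possibilities.
    residual : List Alphabet → Fin R.states → Bool
    residual w q = accepts q (map padʳ (drop n w))

    -- The entry has at most `n` symbols, so the run on the convolution passes through a state fixed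
    -- by the prefix and the entry, and the residual decides from there.
    type≡accepts : ∀ P i → P i ≡
      residual (realisation P) (R.run R.start (conv (take n (realisation P)) (proj₁ (entry i))))
    type≡accepts P i = begin
      P i
        ≡⟨ ⇔→≡ (lang⇔ (conv x y) ⇔-∘ (edge⇔ ⇔-∘ ⇔-sym (proj₂ (extension short P) i))) ⟩
      accepts R.start (conv x y)
        ≡⟨ cong (accepts R.start) (conv-split n x y (proj₁ (domainWords⁻ {n} (∈-lookup i)))) ⟩
      accepts R.start (conv (take n x) y ++ map padʳ (drop n x))
        ≡⟨ cong (Vec.lookup R.final) (foldl-++ R.step R.start (conv (take n x) y) _) ⟩
      residual x (R.run R.start (conv (take n x) y)) ∎
      where
      open ≡-Reasoning
      x = realisation P
      y = proj₁ (entry i)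

      edge⇔ : Edge G (proj₁ (extension short P)) (at short i) ⇔ Language ℛ (conv x y)
      -- `at short i` is the preimage of `entry i`, and `to` brings it back only up to propositional
      -- equality.
      edge⇔ = subst
        (λ v → Edge G (proj₁ (extension short P)) (at short i) ⇔ Language ℛ (conv x (proj₁ v)))
        (Inverse.strictlyInverseˡ bijection (entry i)) Edge⇔Language

      lang⇔ : ∀ w → Language ℛ w ⇔ accepts R.start w ≡ true
      lang⇔ w = mk⇔ []=⇒lookup (lookup⇒[]= _ _)

    -- Realisations may be arbitrarily long and their prefixes may lie outside the domain. A stem is
    -- a domain word carrying the same prefix and short enough to be counted by `census`.
    stem : ∀ P → ∃[ u ]
      length u ≤ n + 𝒟.states × take n u ≡ take n (realisation P) × Language domain u
    stem P = 𝒟.shorten-beyond n (realisation P) (realisation∈domain P)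

    stem∈ : ∀ P → proj₁ (stem P) ∈ domainWords (n + 𝒟.states)
    stem∈ P = let _ , len , _ , accepted = stem P in ∈-domainWords len accepted

    stemIndex : Type → Fin (census (n + 𝒟.states))
    stemIndex P = index (stem∈ P)

    stemIndex⇒prefix : ∀ P Q → stemIndex P ≡ stemIndex Q →
      take n (realisation P) ≡ take n (realisation Q)
    stemIndex⇒prefix P Q eq = begin
      take n (realisation P)            ≡⟨ prefix P ⟨
      take n (listed (stemIndex P))     ≡⟨ cong (take n ∘ listed) eq ⟩
      take n (listed (stemIndex Q))     ≡⟨ prefix Q ⟩
      take n (realisation Q)            ∎
      where
      open ≡-Reasoning
      listed = lookup (domainWords (n + 𝒟.states))

      prefix : ∀ P → take n (listed (stemIndex P)) ≡ take n (realisation P)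
      prefix P = let _ , _ , u≡ , _ = stem P in
        trans (cong (take n) (sym (lookup-index (stem∈ P)))) u≡

    -- Equal stems give equal prefixes, hence the same state for every entry; equal residuals then
    -- give the same verdict.
    types-distinguished : ∀ {P Q} → stemIndex P ≡ stemIndex Q →
      residual (realisation P) ≗ residual (realisation Q) → P ≗ Q
    types-distinguished {P} {Q} stem≡ residual≗ i = begin
      P i                                              ≡⟨ type≡accepts P i ⟩
      residual (realisation P) (state (realisation P)) ≡⟨ residual≗ _ ⟩
      residual (realisation Q) (state (realisation P))
        ≡⟨ cong (λ u → residual (realisation Q) (R.run R.start (conv u _))) (stemIndex⇒prefix P Q stem≡) ⟩
      residual (realisation Q) (state (realisation Q)) ≡⟨ type≡accepts Q i ⟨
      Q i                                              ∎
      where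
      open ≡-Reasoning
      state = λ x → R.run R.start (conv (take n x) (proj₁ (entry i)))

    2^census≤ : 2 ^ census n ≤ census (n + 𝒟.states) * 2 ^ R.states
    2^census≤ = 2^m≤k*2^n stemIndex (residual ∘ realisation) types-distinguished

  contradictory : ⊥
  contradictory = tower≰exponential census R.states 𝒟.states (suc alphabetSize)
    Types.2^census≤ census≤ census-unbounded

corollary4p3 : (G : Structure graphSignature) → IsRandomGraph G → ¬ (AutomaticPresentation G)
corollary4p3 G random presentation = Presentation.contradictory random presentation
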